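{- Let $M, N$ be terms such that $M \triangleright^* N$. Then there exists a standard reduction sequence $M_1;\ldots;M_n$ with $M_1 = M$ and $M_n = N$.
   Context: **Syntax.** Fix two disjoint countably infinite sets of symbols: variables $x,y,z,\dots$ and constants $a,b,c,\dots$. Terms: $M,N ::= x \mid c \mid \lambda p.M \mid MM$. Data terms: $D ::= c \mid DM$. Patterns: $p,q ::= x \mid d$. Data patterns: $d ::= c \mid dp$. (Patterns need not be linear.) In $\lambda p.M$ all variables of $p$ are bound in $M$; terms are taken modulo $\alpha$-conversion. A substitution is a function $\theta$ from variables to terms with finite domain $\mathrm{dom}(\theta)=\{x : \theta(x)\neq x\}$; it extends (capture-avoiding) to terms, written $\theta M$. **Matching.** For a pattern $p$ and a term $M$ sharing no variables, the judgment $p \ll^{\theta} M$ ($p$ matches $M$ with resulting substitution $\theta$) is defined by: $x \ll^{\{x/N\}} N$; $c \ll^{\emptyset} c$; if $d \ll^{\theta_1} D$, $p \ll^{\theta_2} N$ and $\mathrm{dom}(\theta_1)\cap\mathrm{dom}(\theta_2)=\emptyset$ then $dp \ll^{\theta_1\uplus\theta_2} DN$ (with $\uplus$ the union of substitutions with disjoint domains). Write $p\ll M$ if $p\ll^\theta M$ for some $\theta$, and $p\not\ll M$ otherwise. In a term $(\lambda p.M)N$ the variables of $p$ are always assumed, by $\alpha$-conversion, not to occur free in $N$. **Development.** $\triangleright$ on terms is the least relation, defined together with $\blacktriangleright$ on substitutions, such that: $M\triangleright M$; if $M\triangleright M'$ then $\lambda p.M\triangleright\lambda p.M'$; if $M\triangleright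 M'$ and $N\triangleright N'$ then $MN\triangleright M'N'$; if $M\triangleright M'$, $p\ll^\theta N$ and $\theta\blacktriangleright\theta'$ then $(\lambda p.M)N\triangleright\theta'M'$. Here $\theta\blacktriangleright\theta'$ iff $\mathrm{dom}(\theta)=\mathrm{dom}(\theta')$ and $\theta x\triangleright\theta' x$ for all $x\in\mathrm{dom}(\theta)$. $\triangleright^*$ is the reflexive-transitive closure of $\triangleright$. **Head steps.** The relations $\to_h$ and, for each pattern $p$, $\rightsquigarrow_p$ on terms are the least relations such that: - if $M\to_h M'$ then $MN\to_h M'N$; - if $p\ll^\theta N$ then $(\lambda p.M)N\to_h\theta M$; - if $N\rightsquigarrow_p N'$ then $(\lambda p.M)N\to_h(\lambda p.M)N'$; - if $M\to_h M'$ then $M\rightsquigarrow_d M'$ for every data pattern $d$; - if $D\rightsquigarrow_d D'$ with $D,D'$ data terms then $DM\rightsquigarrow_{dp}D'M$; - if $M\rightsquigarrow_p M'$ and $d\ll D$, with $D$ a data term, then $DM\rightsquigarrow_{dp}DM'$. **Standard reduction sequences** are the finite sequences of terms generated by the rules: - (StdVar) for every variable $x$ and every constant $c$, the one-element sequences $x$ and $c$ are standard; - (StdHead) if $M_2;\ldots;M_k$ is standard and $M_1\to_h M_2$, then $M_1;M_2;\ldots;M_k$ is standard; - (StdAbs) if $M_1;\ldots;M_k$ is standard, then $\lambda p.M_1;\ldots;\lambda p.M_k$ is standard; - (StdApp) if $M_1;\ldots;M_j$ and $N_1;\ldots;N_k$ are standard, then $(M_1N_1);\ldots;(M_jN_1);(M_jN_2);\ldots;(M_jN_k)$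 is standard. -}

module Defs where

open import Data.Fin using (Fin; toℕ; splitAt; _↑ˡ_; _↑ʳ_)
open import Data.Fin.Subset using (Subset; _∩_; Empty)
open import Data.List as List using ()
open import Data.List.NonEmpty as List⁺ using (List⁺; [_]; _∷⁺_; _⁺++_; head; tail; last)
open import Data.Maybe using (Maybe; just; nothing; is-just; _<∣>_)
open import Data.Nat using (ℕ; suc; _+_; _<_)
open import Data.Product using (∃)
open import Data.Sum using ([_,_]′)
open import Data.Vec as Vec using (Vec; lookup; replicate; zipWith; _[_]≔_)
open import Function using (_∘_)
open import Relation.Binary.Construct.Closure.ReflexiveTransitive using (Star)

Const : Set
Const = ℕ

infixl 7 _·_

-- Patterns whose variables are named by Fin m.  A name may occur several
-- times, or not at all.
mutual
  data Pattern (m : ℕ) : Set where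
    var : Fin m → Pattern m
    dat : DataPattern m → Pattern m

  data DataPattern (m : ℕ) : Set where
    con : Const → DataPattern m
    _·_ : DataPattern m → Pattern m → DataPattern m

-- Reading the pattern from left to right, with the names 0, …, i-1 already
-- seen, every name not seen before is the least unused one, and in the end the
-- names seen are 0, …, j-1.
data _⊢_⊣_ {m : ℕ} : ℕ → Pattern m → ℕ → Set where
  new : ∀ {x}                                             → toℕ x ⊢ var x ⊣ suc (toℕ x)
  old : ∀ {i x}      → toℕ x < i                          → i ⊢ var x ⊣ i
  con : ∀ {i c}                                           → i ⊢ dat (con c) ⊣ i
  app : ∀ {i j k d p} → i ⊢ dat d ⊣ j → j ⊢ p ⊣ k         → i ⊢ dat (d · p) ⊣ k

-- Every pattern has exactly one canonical renaming (for the right m), so each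
-- α-class of abstractions has exactly one representative.
Canonical : ∀ {m} → Pattern m → Set
Canonical {m} p = 0 ⊢ p ⊣ m

-- Terms modulo α-conversion, with free variables among n.  In the body of
-- lam {m} p _ M, the first m variables are those of p (variable x of p is
-- x ↑ˡ n) and the remaining n are those of the context.
data Term (n : ℕ) : Set where
  var : Fin n → Term n
  con : Const → Term n
  lam : ∀ {m} (p : Pattern m) → .(Canonical p) → Term (m + n) → Term n
  _·_ : Term n → Term n → Term n

data IsData {n : ℕ} : Term n → Set where
  con : ∀ {c} → IsData (con c)
  app : ∀ {D M} → IsData D → IsData (D · M)

liftRen : ∀ {n k} m → (Fin n → Fin k) → Fin (m + n) → Fin (m + k)
liftRen {k = k} m ρ = [ _↑ˡ k , (m ↑ʳ_) ∘ ρ ]′ ∘ splitAt m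

rename : ∀ {n k} → (Fin n → Fin k) → Term n → Term k
rename ρ (var x)           = var (ρ x)
rename ρ (con c)           = con c
rename ρ (lam {m} p can M) = lam p can (rename (liftRen m ρ) M)
rename ρ (M · N)           = rename ρ M · rename ρ N

liftSub : ∀ {n k} m → (Fin n → Term k) → Fin (m + n) → Term (m + k)
liftSub {k = k} m σ = [ (λ x → var (x ↑ˡ k)) , rename (m ↑ʳ_) ∘ σ ]′ ∘ splitAt m

subst : ∀ {n k} → (Fin n → Term k) → Term n → Term k
subst σ (var x)           = σ x
subst σ (con c)           = con c
subst σ (lam {m} p can M) = lam p can (subst (liftSub m σ) M)
subst σ (M · N)           = subst σ M · subst σ N

-- Substitutions of terms for pattern variables; `nothing` marks a name outside
-- the domain.  Pattern names and the free variables of a term are kept apart,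
-- so a pattern never shares a variable with a term it is matched against.
Substitution : ℕ → ℕ → Set
Substitution m n = Vec (Maybe (Term n)) m

dom : ∀ {m n} → Substitution m n → Subset m
dom = Vec.map is-just

∅ : ∀ {m n} → Substitution m n
∅ = replicate _ nothing

⁅_/_⁆ : ∀ {m n} → Fin m → Term n → Substitution m n
⁅ x / N ⁆ = ∅ [ x ]≔ just N

infixr 6 _⊎_

_⊎_ : ∀ {m n} → Substitution m n → Substitution m n → Substitution m n
_⊎_ = zipWith _<∣>_

infix 4 _≪[_]_ _≪_

data _≪[_]_ {m n : ℕ} : Pattern m → Substitution m n → Term n → Set where
  var : ∀ {x N} → var x ≪[ ⁅ x / N ⁆ ] N
  con : ∀ {c} → dat (con c) ≪[ ∅ ] con c
  app : ∀ {d p D N θ₁ θ₂} → IsData D →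
        dat d ≪[ θ₁ ] D → p ≪[ θ₂ ] N → Empty (dom θ₁ ∩ dom θ₂) →
        dat (d · p) ≪[ θ₁ ⊎ θ₂ ] D · N

_≪_ : ∀ {m n} → Pattern m → Term n → Set
p ≪ M = ∃ λ θ → p ≪[ θ ] M

-- The names of a canonical pattern all occur in it, so a substitution resulting
-- from matching it is defined everywhere.  Such a substitution is given below
-- by its values θ : Vec (Term n) m, and as an element of Substitution m n it is
-- total θ.
total : ∀ {m n} → Vec (Term n) m → Substitution m n
total = Vec.map just

apply : ∀ {m n} → Vec (Term n) m → Term (m + n) → Term n
apply {m} θ = subst ([ lookup θ , var ]′ ∘ splitAt m)

infix 4 _▷_ _▶_ _▷*_

mutual
  data _▷_ {n : ℕ} : Term n → Term n → Set where
    refl : ∀ {M} → M ▷ M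
    lam  : ∀ {m} {p : Pattern m} .{can : Canonical p} {M M'} →
           M ▷ M' → lam p can M ▷ lam p can M'
    app  : ∀ {M M' N N'} → M ▷ M' → N ▷ N' → M · N ▷ M' · N'
    beta : ∀ {m} {p : Pattern m} .{can : Canonical p} {M M' N θ θ'} →
           M ▷ M' → p ≪[ total θ ] N → θ ▶ θ' →
           lam p can M · N ▷ apply θ' M'

  -- Both sides have the same domain, namely all of Fin m.
  _▶_ : ∀ {m n} → Vec (Term n) m → Vec (Term n) m → Set
  θ ▶ θ' = ∀ x → lookup θ x ▷ lookup θ' x

_▷*_ : ∀ {n} → Term n → Term n → Set
_▷*_ = Star _▷_

infix 4 _→ₕ_ _⇝[_]_

mutual
  data _→ₕ_ {n : ℕ} : Term n → Term n → Set where
    app  : ∀ {M M' N} → M →ₕ M' → M · N →ₕ M' · N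
    beta : ∀ {m} {p : Pattern m} .{can : Canonical p} {M N θ} →
           p ≪[ total θ ] N → lam p can M · N →ₕ apply θ M
    arg  : ∀ {m} {p : Pattern m} .{can : Canonical p} {M N N'} →
           N ⇝[ p ] N' → lam p can M · N →ₕ lam p can M · N'

  data _⇝[_]_ {m n : ℕ} : Term n → Pattern m → Term n → Set where
    hd    : ∀ {d M M'} → M →ₕ M' → M ⇝[ dat d ] M'
    left  : ∀ {d p D D' M} → IsData D → IsData D' →
            D ⇝[ dat d ] D' → D · M ⇝[ dat (d · p) ] D' · M
    right : ∀ {d p D M M'} → IsData D →
            M ⇝[ p ] M' → dat d ≪ D → D · M ⇝[ dat (d · p) ] D · M'

data Standard {n : ℕ} : List⁺ (Term n) → Set where
  stdVar  : ∀ {x} → Standard [ var x ]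
  stdCon  : ∀ {c} → Standard [ con c ]
  stdHead : ∀ {M Ms} → M →ₕ head Ms → Standard Ms → Standard (M ∷⁺ Ms)
  stdAbs  : ∀ {m} {p : Pattern m} .{can : Canonical p} {Ms} →
            Standard Ms → Standard (List⁺.map (lam p can) Ms)
  stdApp  : ∀ {Ms Ns} → Standard Ms → Standard Ns →
            Standard (List⁺.map (_· head Ns) Ms ⁺++ List.map (last Ms ·_) (tail Ns))

{-# OPTIONS --safe #-}

-- Head steps precede everything else in a standard sequence, so "M reduces to N
-- by a standard sequence" has an inductive characterisation M ⇛ N: M reaches by
-- head steps a term with the root symbol of N whose immediate subterms are again
-- related to those of N.  The theorem amounts to ⇛ absorbing a development step
-- on the right.  The only interesting case is a contracted redex (λp.P)N with
-- p ≪ N, where M →ₕ* (λp.P₀)B with P₀ ⇛ P and B ⇛ N.  The relation ⇝[ p ] performs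
-- exactly the steps of B ⇛ N that p asks for: it turns B into some B₀ matched by p,
-- with a resulting substitution that is pointwise ⇛-related to that of N.

module Submission where

open import Defs
open import Data.Fin using (Fin; zero; suc; splitAt; _↑ˡ_; _↑ʳ_)
open import Data.Fin.Properties using (splitAt-↑ˡ; splitAt-↑ʳ; splitAt⁻¹-↑ˡ; splitAt⁻¹-↑ʳ)
open import Data.Fin.Subset using (Empty; _∩_)
open import Data.List as List using ([]; _∷_)
open import Data.List.NonEmpty as List⁺ using (List⁺; _∷_; _∷⁺_; _⁺++_; head; last)
open import Data.Maybe.Relation.Binary.Pointwise as Maybeᴾ using (just; nothing)
open import Data.Nat using (ℕ; _+_)
open import Data.Product using (∃; ∃₂; _×_; _,_)
open import Data.Sum using (inj₁; inj₂; [_,_]′)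
open import Data.Vec using (Vec; []; _∷_; lookup)
open import Data.Vec.Relation.Binary.Pointwise.Inductive using (Pointwise; []; _∷_)
open import Function using (_∘_)
open import Relation.Binary.Construct.Closure.ReflexiveTransitive
  using (Star; ε; _◅_; _◅◅_; gmap)
open import Relation.Binary.PropositionalEquality as ≡
  using (_≡_; _≗_; refl; sym; trans; cong; cong₂; module ≡-Reasoning)

private
  variable
    m n k l : ℕ

-- Renaming and substitution

liftSub-cong : ∀ m {σ τ : Fin n → Term k} → σ ≗ τ → liftSub m σ ≗ liftSub m τ
liftSub-cong m eq x with splitAt m x
... | inj₁ y = refl
... | inj₂ y = cong (rename (m ↑ʳ_)) (eq y)

subst-cong : {σ τ : Fin n → Term k} → σ ≗ τ → subst σ ≗ subst τ
subst-cong eq (var x)         = eq x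
subst-cong eq (con c)         = refl
subst-cong eq (lam {m} p c M) = cong (lam p c) (subst-cong (liftSub-cong m eq) M)
subst-cong eq (M · N)         = cong₂ _·_ (subst-cong eq M) (subst-cong eq N)

liftSub-var : ∀ m → liftSub m var ≗ var {m + n}
liftSub-var {n} m x with splitAt m x in eq
... | inj₁ y = cong var (splitAt⁻¹-↑ˡ eq)
... | inj₂ y = cong var (splitAt⁻¹-↑ʳ eq)

subst-var : subst var ≗ (λ (M : Term n) → M)
subst-var (var x)         = refl
subst-var (con c)         = refl
subst-var (lam {m} p c M) = cong (lam p c) (trans (subst-cong (liftSub-var m) M) (subst-var M))
subst-var (M · N)         = cong₂ _·_ (subst-var M) (subst-var N)

liftSub-var∘ : ∀ m (ρ : Fin n → Fin k) → liftSub m (var ∘ ρ) ≗ var ∘ liftRen m ρ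
liftSub-var∘ m ρ x with splitAt m x
... | inj₁ y = refl
... | inj₂ y = refl

-- Lets facts about substitution, such as stability of head steps, carry over to renaming.
rename≗subst : (ρ : Fin n → Fin k) → rename ρ ≗ subst (var ∘ ρ)
rename≗subst ρ (var x)         = refl
rename≗subst ρ (con c)         = refl
rename≗subst ρ (lam {m} p c M) = cong (lam p c)
  (trans (rename≗subst (liftRen m ρ) M) (subst-cong (sym ∘ liftSub-var∘ m ρ) M))
rename≗subst ρ (M · N)         = cong₂ _·_ (rename≗subst ρ M) (rename≗subst ρ N)

liftSub-liftRen : ∀ m (σ : Fin k → Term l) (ρ : Fin n → Fin k) →
                  liftSub m σ ∘ liftRen m ρ ≗ liftSub m (σ ∘ ρ)
liftSub-liftRen {k = k} m σ ρ x with splitAt m x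
... | inj₁ y rewrite splitAt-↑ˡ m y k     = refl
... | inj₂ y rewrite splitAt-↑ʳ m k (ρ y) = refl

-- Comes before `rename-subst` and `subst-subst`: under a binder both meet the weakening
-- `rename (m ↑ʳ_)`, and this law absorbs it.
subst-rename : (σ : Fin k → Term l) (ρ : Fin n → Fin k) →
               subst σ ∘ rename ρ ≗ subst (σ ∘ ρ)
subst-rename σ ρ (var x)         = refl
subst-rename σ ρ (con c)         = refl
subst-rename σ ρ (lam {m} p c M) = cong (lam p c)
  (trans (subst-rename (liftSub m σ) (liftRen m ρ) M) (subst-cong (liftSub-liftRen m σ ρ) M))
subst-rename σ ρ (M · N)         = cong₂ _·_ (subst-rename σ ρ M) (subst-rename σ ρ N)

rename-rename : (ρ : Fin k → Fin l) (ρ' : Fin n → Fin k) →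
                rename ρ ∘ rename ρ' ≗ subst (var ∘ ρ ∘ ρ')
rename-rename ρ ρ' M = trans (rename≗subst ρ (rename ρ' M)) (subst-rename (var ∘ ρ) ρ' M)

liftRen-liftSub : ∀ m (ρ : Fin k → Fin l) (σ : Fin n → Term k) →
                  rename (liftRen m ρ) ∘ liftSub m σ ≗ liftSub m (rename ρ ∘ σ)
liftRen-liftSub {k = k} {l} m ρ σ x with splitAt m x
... | inj₁ y rewrite splitAt-↑ˡ m y k = refl
... | inj₂ y = begin
  rename (liftRen m ρ) (rename (m ↑ʳ_) (σ y))  ≡⟨ rename-rename (liftRen m ρ) (m ↑ʳ_) (σ y) ⟩
  subst (var ∘ liftRen m ρ ∘ (m ↑ʳ_)) (σ y)    ≡⟨ subst-cong liftRen-↑ʳ (σ y) ⟩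
  subst (var ∘ (m ↑ʳ_) ∘ ρ) (σ y)              ≡⟨ rename-rename (m ↑ʳ_) ρ (σ y) ⟨
  rename (m ↑ʳ_) (rename ρ (σ y))              ∎
  where
  open ≡-Reasoning
  liftRen-↑ʳ : var ∘ liftRen m ρ ∘ (m ↑ʳ_) ≗ var ∘ (m ↑ʳ_) ∘ ρ
  liftRen-↑ʳ z rewrite splitAt-↑ʳ m k z = refl

rename-subst : (ρ : Fin k → Fin l) (σ : Fin n → Term k) →
               rename ρ ∘ subst σ ≗ subst (rename ρ ∘ σ)
rename-subst ρ σ (var x)         = refl
rename-subst ρ σ (con c)         = refl
rename-subst ρ σ (lam {m} p c M) = cong (lam p c)
  (trans (rename-subst (liftRen m ρ) (liftSub m σ) M) (subst-cong (liftRen-liftSub m ρ σ) M))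
rename-subst ρ σ (M · N)         = cong₂ _·_ (rename-subst ρ σ M) (rename-subst ρ σ N)

liftSub-liftSub : ∀ m (τ : Fin k → Term l) (σ : Fin n → Term k) →
                  subst (liftSub m τ) ∘ liftSub m σ ≗ liftSub m (subst τ ∘ σ)
liftSub-liftSub {k = k} m τ σ x with splitAt m x
... | inj₁ y rewrite splitAt-↑ˡ m y k = refl
... | inj₂ y = begin
  subst (liftSub m τ) (rename (m ↑ʳ_) (σ y))  ≡⟨ subst-rename (liftSub m τ) (m ↑ʳ_) (σ y) ⟩
  subst (liftSub m τ ∘ (m ↑ʳ_)) (σ y)         ≡⟨ subst-cong liftSub-↑ʳ (σ y) ⟩
  subst (rename (m ↑ʳ_) ∘ τ) (σ y)            ≡⟨ rename-subst (m ↑ʳ_) τ (σ y) ⟨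
  rename (m ↑ʳ_) (subst τ (σ y))              ∎
  where
  open ≡-Reasoning
  liftSub-↑ʳ : liftSub m τ ∘ (m ↑ʳ_) ≗ rename (m ↑ʳ_) ∘ τ
  liftSub-↑ʳ z rewrite splitAt-↑ʳ m k z = refl

subst-subst : (τ : Fin k → Term l) (σ : Fin n → Term k) →
              subst τ ∘ subst σ ≗ subst (subst τ ∘ σ)
subst-subst τ σ (var x)         = refl
subst-subst τ σ (con c)         = refl
subst-subst τ σ (lam {m} p c M) = cong (lam p c)
  (trans (subst-subst (liftSub m τ) (liftSub m σ) M) (subst-cong (liftSub-liftSub m τ σ) M))
subst-subst τ σ (M · N)         = cong₂ _·_ (subst-subst τ σ M) (subst-subst τ σ N)

-- The contractum of a substituted redex is the substituted contractum; this is what the `beta` case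
-- of `→ₕ-subst` requires.
subst-apply : (σ : Fin n → Term k) (θ : Vec (Term n) m) (θ' : Vec (Term k) m) →
              lookup θ' ≗ subst σ ∘ lookup θ → ∀ M →
              apply θ' (subst (liftSub m σ) M) ≡ subst σ (apply θ M)
subst-apply {n} {k} {m} σ θ θ' eq M = begin
  apply θ' (subst (liftSub m σ) M)      ≡⟨ subst-subst inst' (liftSub m σ) M ⟩
  subst (subst inst' ∘ liftSub m σ) M   ≡⟨ subst-cong pointwise M ⟩
  subst (subst σ ∘ inst) M              ≡⟨ subst-subst σ inst M ⟨
  subst σ (apply θ M)                   ∎
  where
  open ≡-Reasoning
  inst : Fin (m + n) → Term n
  inst = [ lookup θ , var ]′ ∘ splitAt m
  inst' : Fin (m + k) → Term k
  inst' = [ lookup θ' , var ]′ ∘ splitAt m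
  inst'-↑ʳ : inst' ∘ (m ↑ʳ_) ≗ var
  inst'-↑ʳ z rewrite splitAt-↑ʳ m k z = refl
  pointwise : subst inst' ∘ liftSub m σ ≗ subst σ ∘ inst
  pointwise x with splitAt m x
  ... | inj₁ y rewrite splitAt-↑ˡ m y k = eq y
  -- For a context variable, `σ y` is weakened past the pattern variables, so instantiating those
  -- leaves it unchanged.
  ... | inj₂ y = begin
    subst inst' (rename (m ↑ʳ_) (σ y))  ≡⟨ subst-rename inst' (m ↑ʳ_) (σ y) ⟩
    subst (inst' ∘ (m ↑ʳ_)) (σ y)       ≡⟨ subst-cong inst'-↑ʳ (σ y) ⟩
    subst var (σ y)                     ≡⟨ subst-var (σ y) ⟩
    σ y                                 ∎

-- Pointwise related substitutions

-- Undefined entries are related only to undefined ones, so related substitutions have equal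
-- domains. Partiality is kept because matching a subpattern binds only some of the names.
SubstitutionRel : (Term n → Term k → Set) → Substitution m n → Substitution m k → Set
SubstitutionRel R = Pointwise (Maybeᴾ.Pointwise R)

module _ {R : Term n → Term k → Set} where

  ∅-rel : SubstitutionRel R (∅ {m}) ∅
  ∅-rel {ℕ.zero}  = []
  ∅-rel {ℕ.suc m} = nothing ∷ ∅-rel

  ⁅/⁆-rel : ∀ {M N} (x : Fin m) → R M N → SubstitutionRel R ⁅ x / M ⁆ ⁅ x / N ⁆
  ⁅/⁆-rel zero    r = just r ∷ ∅-rel
  ⁅/⁆-rel (suc x) r = nothing ∷ ⁅/⁆-rel x r

  -- `_⊎_` prefers its left operand; as the left operands are defined at the same names, both unions
  -- make the same choice.
  ⊎-rel : {θ₁ θ₂ : Substitution m n} {θ₁' θ₂' : Substitution m k} →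
          SubstitutionRel R θ₁ θ₁' → SubstitutionRel R θ₂ θ₂' →
          SubstitutionRel R (θ₁ ⊎ θ₂) (θ₁' ⊎ θ₂')
  ⊎-rel []             []       = []
  ⊎-rel (just r  ∷ rs) (_ ∷ ss) = just r ∷ ⊎-rel rs ss
  ⊎-rel (nothing ∷ rs) (s ∷ ss) = s ∷ ⊎-rel rs ss

  dom-rel : {θ : Substitution m n} {θ' : Substitution m k} →
            SubstitutionRel R θ θ' → dom θ ≡ dom θ'
  dom-rel []             = refl
  dom-rel (just _  ∷ rs) = cong (_ ∷_) (dom-rel rs)
  dom-rel (nothing ∷ rs) = cong (_ ∷_) (dom-rel rs)

  disjoint-rel : {θ₁ θ₂ : Substitution m n} {θ₁' θ₂' : Substitution m k} →
                 SubstitutionRel R θ₁ θ₁' → SubstitutionRel R θ₂ θ₂' →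
                 Empty (dom θ₁' ∩ dom θ₂') → Empty (dom θ₁ ∩ dom θ₂)
  disjoint-rel rs ss rewrite dom-rel rs | dom-rel ss = λ e → e

  -- Equality of domains makes `Θ` total, which puts it in the form that `beta` demands.
  total-rel⁻ : {Θ : Substitution m n} (θ' : Vec (Term k) m) → SubstitutionRel R Θ (total θ') →
               ∃ λ θ → Θ ≡ total θ × (∀ x → R (lookup θ x) (lookup θ' x))
  total-rel⁻ []       []            = [] , refl , λ ()
  total-rel⁻ (_ ∷ θ') (just r ∷ rs) with total-rel⁻ θ' rs
  ... | θ , refl , rθ = _ ∷ θ , refl , λ { zero → r ; (suc x) → rθ x }

-- Stability of matching and head steps under substitution

IsData-subst : (σ : Fin n → Term k) → ∀ {D} → IsData D → IsData (subst σ D)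
IsData-subst σ con     = con
IsData-subst σ (app d) = app (IsData-subst σ d)

≪-IsData : ∀ {d : DataPattern m} {θ} {D : Term n} → dat d ≪[ θ ] D → IsData D
≪-IsData con           = con
≪-IsData (app d _ _ _) = app d

-- Matching inspects only constants and applications in data position, and substitution preserves
-- both; the bound terms are merely substituted into.
≪-subst : (σ : Fin n → Term k) → ∀ {p : Pattern m} {θ N} → p ≪[ θ ] N →
          ∃ λ θ' → p ≪[ θ' ] subst σ N × SubstitutionRel (λ M' M → M' ≡ subst σ M) θ' θ
≪-subst σ {p = var x} var = _ , var , ⁅/⁆-rel x refl
≪-subst σ con             = _ , con , ∅-rel
≪-subst σ (app d a b e)   with ≪-subst σ a | ≪-subst σ b
... | _ , a' , r | _ , b' , s =
  _ , app (IsData-subst σ d) a' b' (disjoint-rel r s e) , ⊎-rel r s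

mutual
  →ₕ-subst : (σ : Fin n → Term k) → ∀ {M M'} → M →ₕ M' → subst σ M →ₕ subst σ M'
  →ₕ-subst σ (app h) = app (→ₕ-subst σ h)
  →ₕ-subst σ (beta {M = M} {θ = θ} a) with ≪-subst σ a
  ... | _ , a' , r with total-rel⁻ θ r
  ... | θ' , refl , eq = ≡.subst (_ →ₕ_) (subst-apply σ θ θ' eq M) (beta a')
  →ₕ-subst σ (arg s) = arg (⇝-subst σ s)

  ⇝-subst : (σ : Fin n → Term k) → ∀ {p : Pattern m} {M M'} →
            M ⇝[ p ] M' → subst σ M ⇝[ p ] subst σ M'
  ⇝-subst σ (hd h)        = hd (→ₕ-subst σ h)
  ⇝-subst σ (left d d' s) = left (IsData-subst σ d) (IsData-subst σ d') (⇝-subst σ s)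
  ⇝-subst σ (right d s (_ , a)) with ≪-subst σ a
  ... | θ' , a' , _ = right (IsData-subst σ d) (⇝-subst σ s) (θ' , a')

→ₕ-rename : (ρ : Fin n → Fin k) → ∀ {M M'} → M →ₕ M' → rename ρ M →ₕ rename ρ M'
→ₕ-rename ρ {M} {M'} h
  rewrite rename≗subst ρ M | rename≗subst ρ M' = →ₕ-subst (var ∘ ρ) h

-- The inductive form of standard reduction

infix 4 _→ₕ*_ _⇛_

_→ₕ*_ : Term n → Term n → Set
_→ₕ*_ = Star _→ₕ_

data _⇛_ {n : ℕ} (M : Term n) : Term n → Set where
  var : ∀ {x} → M →ₕ* var x → M ⇛ var x
  con : ∀ {c} → M →ₕ* con c → M ⇛ con c
  lam : ∀ {m} {p : Pattern m} .{can : Canonical p} {P P'} →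
        M →ₕ* lam p can P → P ⇛ P' → M ⇛ lam p can P'
  app : ∀ {P Q P' Q'} → M →ₕ* P · Q → P ⇛ P' → Q ⇛ Q' → M ⇛ P' · Q'

⇛-refl : (M : Term n) → M ⇛ M
⇛-refl (var x)     = var ε
⇛-refl (con c)     = con ε
⇛-refl (lam p c M) = lam ε (⇛-refl M)
⇛-refl (M · N)     = app ε (⇛-refl M) (⇛-refl N)

→ₕ*-⇛ : {M M' N : Term n} → M →ₕ* M' → M' ⇛ N → M ⇛ N
→ₕ*-⇛ hs (var hs')     = var (hs ◅◅ hs')
→ₕ*-⇛ hs (con hs')     = con (hs ◅◅ hs')
→ₕ*-⇛ hs (lam hs' s)   = lam (hs ◅◅ hs') s
→ₕ*-⇛ hs (app hs' s t) = app (hs ◅◅ hs') s t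

⇛-rename : (ρ : Fin n → Fin k) → ∀ {M N} → M ⇛ N → rename ρ M ⇛ rename ρ N
⇛-rename ρ (var hs)           = var (gmap (rename ρ) (→ₕ-rename ρ) hs)
⇛-rename ρ (con hs)           = con (gmap (rename ρ) (→ₕ-rename ρ) hs)
⇛-rename ρ (lam {m = m} hs s) =
  lam (gmap (rename ρ) (→ₕ-rename ρ) hs) (⇛-rename (liftRen m ρ) s)
⇛-rename ρ (app hs s t)       =
  app (gmap (rename ρ) (→ₕ-rename ρ) hs) (⇛-rename ρ s) (⇛-rename ρ t)

⇛-liftSub : ∀ m {σ τ : Fin n → Term k} → (∀ x → σ x ⇛ τ x) → ∀ x → liftSub m σ x ⇛ liftSub m τ x
⇛-liftSub m r x with splitAt m x
... | inj₁ y = var ε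
... | inj₂ y = ⇛-rename (m ↑ʳ_) (r y)

⇛-subst : {σ τ : Fin n → Term k} → (∀ x → σ x ⇛ τ x) → ∀ {M N} → M ⇛ N → subst σ M ⇛ subst τ N
-- The head steps to `var x` become head steps to `σ x`, and are then prepended to `σ x ⇛ τ x`.
⇛-subst {σ = σ} r (var {x} hs)       = →ₕ*-⇛ (gmap (subst σ) (→ₕ-subst σ) hs) (r x)
⇛-subst {σ = σ} r (con hs)           = con (gmap (subst σ) (→ₕ-subst σ) hs)
⇛-subst {σ = σ} r (lam {m = m} hs s) =
  lam (gmap (subst σ) (→ₕ-subst σ) hs) (⇛-subst (⇛-liftSub m r) s)
⇛-subst {σ = σ} r (app hs s t)       =
  app (gmap (subst σ) (→ₕ-subst σ) hs) (⇛-subst r s) (⇛-subst r t)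

⇛-apply : (θ θ' : Vec (Term n) m) → (∀ x → lookup θ x ⇛ lookup θ' x) →
          ∀ {M N} → M ⇛ N → apply θ M ⇛ apply θ' N
⇛-apply {m = m} θ θ' r = ⇛-subst pointwise
  where
  pointwise : ∀ x → [ lookup θ , var ]′ (splitAt m x) ⇛ [ lookup θ' , var ]′ (splitAt m x)
  pointwise x with splitAt m x
  ... | inj₁ y = r y
  ... | inj₂ y = var ε

-- Only a head step can lead from a non-data term.
⇝-app : ∀ {d : DataPattern m} {p} {D D' M : Term n} →
        D ⇝[ dat d ] D' → D · M ⇝[ dat (d · p) ] D' · M
⇝-app (hd h)           = hd (app h)
⇝-app s@(left d d' _)  = left (app d) (app d') s
⇝-app s@(right d _ _)  = left (app d) (app d) s

-- Induction on the match. A variable pattern asks for no step, so the whole of `M ⇛ N` passes into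
-- the substitution; a constant asks for all the head steps. Disjointness transfers since related
-- substitutions have equal domains.
⇛-≪ : ∀ {p : Pattern m} {θ} {M N : Term n} → p ≪[ θ ] N → M ⇛ N →
      ∃₂ λ M₀ θ₀ → Star _⇝[ p ]_ M M₀ × p ≪[ θ₀ ] M₀ × SubstitutionRel _⇛_ θ₀ θ
⇛-≪ {p = var x} var s    = _ , _ , ε , var , ⁅/⁆-rel x s
⇛-≪ con         (con hs) = _ , _ , gmap _ hd hs , con , ∅-rel
⇛-≪ (app _ a b e) (app {Q = Q} hs s t) with ⇛-≪ a s | ⇛-≪ b t
... | D₀ , θ₁ , ss , a₀ , r | _ , _ , ts , b₀ , r' =
  _ , _ ,
  -- First the head steps exposing an application, then the steps on its left part until `d` matches
  -- `D₀`, and only then those on `Q`, since `right` presupposes that match.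
  gmap _ hd hs ◅◅ gmap (_· Q) ⇝-app ss ◅◅ gmap (D₀ ·_) (λ u → right d₀ u (θ₁ , a₀)) ts ,
  app d₀ a₀ b₀ (disjoint-rel r r' e) , ⊎-rel r r'
  where d₀ = ≪-IsData a₀

-- The induction is on the development step: in a contraction the relations `rθ x` are built by
-- `⇛-≪` and need not be parts of the given derivation, whereas `v x` is a smaller development.
⇛-▷ : {M N N' : Term n} → M ⇛ N → N ▷ N' → M ⇛ N'
⇛-▷ s            refl      = s
⇛-▷ (lam hs s)   (lam u)   = lam hs (⇛-▷ s u)
⇛-▷ (app hs s t) (app u v) = app hs (⇛-▷ s u) (⇛-▷ t v)
⇛-▷ (app hs (lam {can = can} hs' s) t) (beta {θ = θ} {θ'} u a v) with ⇛-≪ a t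
... | _ , _ , ts , a₀ , r with total-rel⁻ θ r
... | θ₀ , refl , rθ =
  -- Head steps expose the application, then the abstraction in its function part, then make the
  -- argument match; the last one contracts the redex.
  →ₕ*-⇛ (hs ◅◅ gmap (_· _) app hs' ◅◅ gmap (_ ·_) (arg {can = can}) ts ◅◅ beta a₀ ◅ ε)
        (⇛-apply θ₀ θ' (λ x → ⇛-▷ (rθ x) (v x)) (⇛-▷ s u))

▷*-⇛ : {M N N' : Term n} → M ⇛ N → N ▷* N' → M ⇛ N'
▷*-⇛ s ε        = s
▷*-⇛ s (u ◅ us) = ▷*-⇛ (⇛-▷ s u) us

-- Last elements of nonempty lists

module _ {A : Set} where

  -- `last` views the list from its end through `initLast`, so it does not reduce on a cons until
  -- that view is split.
  last-∷⁺ : (x : A) (xs : List⁺ A) → last (x ∷⁺ xs) ≡ last xs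
  last-∷⁺ x (y ∷ ys) with List.initLast ys
  ... | []           = refl
  ... | _ List.∷ʳ′ _ = refl

  last-⁺++ : ∀ (x : A) xs ys → last ((x ∷ xs) ⁺++ ys) ≡ last (last (x ∷ xs) ∷ ys)
  last-⁺++ x []       ys = refl
  last-⁺++ x (y ∷ xs) ys = begin
    last (x ∷ y ∷ xs List.++ ys)    ≡⟨ last-∷⁺ x (y ∷ xs List.++ ys) ⟩
    last ((y ∷ xs) ⁺++ ys)          ≡⟨ last-⁺++ y xs ys ⟩
    last (last (y ∷ xs) ∷ ys)       ≡⟨ cong (λ z → last (z ∷ ys)) (last-∷⁺ x (y ∷ xs)) ⟨
    last (last (x ∷ y ∷ xs) ∷ ys)   ∎
    where open ≡-Reasoning

last-map : ∀ {A B : Set} (f : A → B) x xs → last (List⁺.map f (x ∷ xs)) ≡ f (last (x ∷ xs))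
last-map f x []       = refl
last-map f x (y ∷ xs) = begin
  last (List⁺.map f (x ∷ y ∷ xs))  ≡⟨ last-∷⁺ (f x) (List⁺.map f (y ∷ xs)) ⟩
  last (List⁺.map f (y ∷ xs))      ≡⟨ last-map f y xs ⟩
  f (last (y ∷ xs))                ≡⟨ cong f (last-∷⁺ x (y ∷ xs)) ⟨
  f (last (x ∷ y ∷ xs))            ∎
  where open ≡-Reasoning

last-stdApp : ∀ (M : Term n) Ms N Ns →
  last (List⁺.map (_· N) (M ∷ Ms) ⁺++ List.map (last (M ∷ Ms) ·_) Ns) ≡
  last (M ∷ Ms) · last (N ∷ Ns)
last-stdApp M Ms N Ns = begin
  last (List⁺.map (_· N) (M ∷ Ms) ⁺++ Qs)       ≡⟨ last-⁺++ (M · N) (List.map (_· N) Ms) Qs ⟩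
  last (last (List⁺.map (_· N) (M ∷ Ms)) ∷ Qs)  ≡⟨ cong (λ P → last (P ∷ Qs)) (last-map (_· N) M Ms) ⟩
  -- `M' · N` ends the first half and is exactly the term that the second half omits; restoring it
  -- in front of `Qs` gives the full mapped list by computation.
  last (List⁺.map (M' ·_) (N ∷ Ns))             ≡⟨ last-map (M' ·_) N Ns ⟩
  M' · last (N ∷ Ns)                            ∎
  where
  open ≡-Reasoning
  M' = last (M ∷ Ms)
  Qs = List.map (M' ·_) Ns

-- From the inductive form to standard sequences

Standardizes : Term n → Term n → Set
Standardizes M N = ∃ λ Ms → Standard Ms × head Ms ≡ M × last Ms ≡ N

→ₕ*-standardizes : {M M' N : Term n} → M →ₕ* M' → Standardizes M' N → Standardizes M N
→ₕ*-standardizes ε        s = s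
→ₕ*-standardizes (h ◅ hs) s with →ₕ*-standardizes hs s
... | Ms , std , refl , refl = _ ∷⁺ Ms , stdHead h std , refl , last-∷⁺ _ Ms

-- Each constructor of `⇛` supplies one of the rules for variables, constants, abstractions and
-- applications, and its head steps are prepended by `stdHead`.
⇛-standardizes : {M N : Term n} → M ⇛ N → Standardizes M N
⇛-standardizes (var hs)   = →ₕ*-standardizes hs (_ , stdVar , refl , refl)
⇛-standardizes (con hs)   = →ₕ*-standardizes hs (_ , stdCon , refl , refl)
⇛-standardizes (lam hs s) with ⇛-standardizes s
... | P ∷ Ps , std , refl , refl = →ₕ*-standardizes hs (_ , stdAbs std , refl , last-map _ P Ps)
⇛-standardizes (app hs s t) with ⇛-standardizes s | ⇛-standardizes t
... | P ∷ Ps , std , refl , refl | Q ∷ Qs , std' , refl , refl =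
  →ₕ*-standardizes hs (_ , stdApp std std' , refl , last-stdApp P Ps Q Qs)

theorem6p5 : (n : ℕ) (M N : Term n) → M ▷* N →
    ∃ λ (Ms : List⁺ (Term n)) → Standard Ms × head Ms ≡ M × last Ms ≡ N
theorem6p5 n M N us = ⇛-standardizes (▷*-⇛ (⇛-refl M) us)
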